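{- There exists a deterministic algorithm that, given a game graph $G=(V,E,w)$ without negative cycles (that is, no directed cycle of $G$ has negative total weight), computes the minimum sufficient energy $e^*(v)$ of all vertices $v\in V$ in $O(mn)$ time.
   Context: A game graph is a finite weighted directed graph $G=(V,E,w)$ in which every vertex has at least one outgoing edge, with integer edge weights in $\{ -W,-W+1,\dots,W\}$, and with $V$ partitioned into $V_A$ (vertices controlled by Alice) and $V_B$ (vertices controlled by Bob). Let $n=|V|$ and $m=|E|$. A positional strategy of Alice is a map $\sigma\colon V_A\to V$ with $(v,\sigma(v))\in E$ for all $v\in V_A$; a positional strategy of Bob is a map $\tau\colon V_B\to V$ with $(v,\tau(v))\in E$ for all $v\in V_B$. Let $G(\sigma,\tau)$ be the subgraph on $V$ with edges $\{(v,\sigma(v)):v\in V_A\}\cup\{(v,\tau(v)):v\in V_B\}$. For $s\in V$ let $P_i$ be the unique path of length $i$ starting at $s$ in $G(\sigma,\tau)$, and let $w(P_i)$ be the sum of its edge weights (so $w(P_0)=0$). Define $e_{\sigma,\tau}(s):=\max\{0,-\inf_{i\ge 0}w(P_i)\}\in\mathbb{Z}_{\ge 0}\cup\{\infty\}$, and the minimum sufficient energy at $s$ by $e^*(s):=\min_\sigma\max_\tau e_{\sigma,\tau}(s)$, over all positional strategies $\sigma$ of Alice and $\tau$ of Bob. -}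

module Defs where

open import Data.Bool using (if_then_else_; _∧_)
open import Data.Fin using (Fin; zero; suc; toℕ)
open import Data.Integer using (ℤ; +_; -[1+_]; 0ℤ; ∣_∣; -_) renaming
  (_+_ to _+ℤ_; _-_ to _-ℤ_; _⊔_ to _⊔ℤ_; _≤_ to _≤ℤ_; _<_ to _<ℤ_)
import Data.Integer.Properties as ℤₚ
open import Data.List using (List; []; _∷_)
open import Data.List.Relation.Unary.Unique.Propositional using (Unique)
open import Data.Nat using (ℕ; zero; suc; _+_; _*_; _≤_; _≡ᵇ_)
open import Data.Product using (∃-syntax; _×_; _,_; proj₁; proj₂)
open import Function.Definitions using (Injective)
open import Relation.Binary.Construct.Add.Infimum.NonStrict _≤ℤ_ using (_≤₋_)
open import Relation.Binary.Construct.Add.Supremum.NonStrict _≤_ using (_≤⁺_)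
open import Relation.Binary.PropositionalEquality
  using (_≡_; _≢_; refl)
open import Relation.Nullary using (contradiction)
open import Relation.Nullary.Construct.Add.Infimum using (_₋; ⊥₋; [_])
open import Relation.Nullary.Construct.Add.Supremum using (_⁺; ⊤⁺)

------------------------------------------------------------------------
-- Game graphs

data Player : Set where
  alice bob : Player

-- The edge set is given by a duplicate-free enumeration in arbitrary order.
-- Self-loops are allowed, parallel edges are not.
record GameGraph : Set where
  field
    n m            : ℕ
    W              : ℕ
    owner          : Fin n → Player
    edge           : Fin m → Fin n × Fin n
    edge-injective : Injective _≡_ _≡_ edge
    w              : Fin m → ℤ
    w-bounded      : ∀ e → ∣ w e ∣ ≤ W
    has-out-edge   : ∀ u → ∃[ e ] proj₁ (edge e) ≡ u

module Game (G : GameGraph) where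
  open GameGraph G

  V : Set
  V = Fin n

  E : V → V → Set
  E u v = ∃[ e ] edge e ≡ (u , v)

  data Walk : V → V → Set where
    []  : ∀ {v} → Walk v v
    _∷_ : ∀ {u v t} → E u v → Walk v t → Walk u t

  weight : ∀ {u v} → Walk u v → ℤ
  weight []            = 0ℤ
  weight ((e , _) ∷ p) = w e +ℤ weight p

  -- The starting vertex of every edge of a walk, so the final vertex of a
  -- closed walk is not counted twice.
  sources : ∀ {u v} → Walk u v → List V
  sources []            = []
  sources (_∷_ {u} _ p) = u ∷ sources p

  IsCycle : ∀ {v} → Walk v v → Set
  IsCycle p = sources p ≢ [] × Unique (sources p)

  NoNegativeCycle : Set
  NoNegativeCycle = ∀ {v} (p : Walk v v) → IsCycle p → 0ℤ ≤ℤ weight p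

  record Strategy (P : Player) : Set where
    field
      move   : (v : V) → owner v ≡ P → V
      isEdge : (v : V) (o : owner v ≡ P) → E v (move v o)

  module Play (σ : Strategy alice) (τ : Strategy bob) where

    chosen : (v : V) (P : Player) → owner v ≡ P → ∃[ u ] E v u
    chosen v alice o = Strategy.move σ v o , Strategy.isEdge σ v o
    chosen v bob   o = Strategy.move τ v o , Strategy.isEdge τ v o

    -- The unique outgoing edge of v in G(σ,τ).
    next : (v : V) → ∃[ u ] E v u
    next v = chosen v (owner v) refl

    path : (i : ℕ) (s : V) → ∃[ t ] Walk s t
    path zero    s = s , []
    path (suc i) s = let (u , e) = next s ; (t , p) = path i u in t , e ∷ p

    pathWeight : V → ℕ → ℤ
    pathWeight s i = weight (proj₂ (path i s))

  -- Infimum of a sequence of integers in ℤ ∪ {-∞}.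
  IsInfimum : (ℕ → ℤ) → ℤ ₋ → Set
  IsInfimum f x = (∀ i → x ≤₋ [ f i ]) × (∀ y → (∀ i → y ≤₋ [ f i ]) → y ≤₋ x)

  -- max {0, -x}; the argument of ∣_∣ is nonnegative.
  max0- : ℤ ₋ → ℕ ⁺
  max0- ⊥₋    = ⊤⁺
  max0- [ z ] = [ ∣ 0ℤ ⊔ℤ (- z) ∣ ]

  -- Infima, maxima and minima are not computable in general, so the energies
  -- are given by the graphs of the (partial) functions defining them.
  IsEnergy : Strategy alice → Strategy bob → V → ℕ ⁺ → Set
  IsEnergy σ τ s x = ∃[ y ] IsInfimum (Play.pathWeight σ τ s) y × x ≡ max0- y

  IsMaxEnergy : Strategy alice → V → ℕ ⁺ → Set
  IsMaxEnergy σ s x =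
    (∃[ τ ] IsEnergy σ τ s x) × (∀ τ y → IsEnergy σ τ s y → y ≤⁺ x)

  IsMinSufficientEnergy : V → ℕ ⁺ → Set
  IsMinSufficientEnergy s x =
    (∃[ σ ] IsMaxEnergy σ s x) × (∀ σ y → IsMaxEnergy σ s y → x ≤⁺ y)

open Game public using (NoNegativeCycle; IsMinSufficientEnergy)

------------------------------------------------------------------------
-- Algorithms: while programs on a word RAM.
--
-- The memory consists of integer arrays, of which a program can only name
-- finitely many; indices are computed.  Operations have unit cost, and are
-- defined only as long as no result exceeds the word bound B in absolute
-- value.

Memory : Set
Memory = ℕ → ℕ → ℤ

_[_,_]≔_ : Memory → ℕ → ℕ → ℤ → Memory
(M [ a , k ]≔ z) b l = if (a ≡ᵇ b) ∧ (k ≡ᵇ l) then z else M b l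

infixl 6 _⊕_ _⊖_
infix  4 _⟨_⟩≔_
infixr 3 _⨾_

data Expr : Set where
  lit     : ℤ → Expr
  _⟨_⟩    : ℕ → Expr → Expr
  _⊕_ _⊖_ : Expr → Expr → Expr

data Program : Set where
  skip     : Program
  _⟨_⟩≔_   : ℕ → Expr → Expr → Program
  _⨾_      : Program → Program → Program
  ifPos    : Expr → Program → Program → Program
  whilePos : Expr → Program → Program

-- Eval B M e z t : expression e evaluates in memory M to z at cost t.
data Eval (B : ℕ) (M : Memory) : Expr → ℤ → ℕ → Set where
  lit  : ∀ {z} → ∣ z ∣ ≤ B → Eval B M (lit z) z 1
  load : ∀ {a e k z t} → Eval B M e (+ k) t → z ≡ M a k →
         Eval B M (a ⟨ e ⟩) z (suc t)
  add  : ∀ {e f x y z s t} → Eval B M e x s → Eval B M f y t →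
         z ≡ x +ℤ y → ∣ z ∣ ≤ B → Eval B M (e ⊕ f) z (suc (s + t))
  sub  : ∀ {e f x y z s t} → Eval B M e x s → Eval B M f y t →
         z ≡ x -ℤ y → ∣ z ∣ ≤ B → Eval B M (e ⊖ f) z (suc (s + t))

-- Exec B p M N t : program p, started in M, halts in N after t steps.
data Exec (B : ℕ) : Program → Memory → Memory → ℕ → Set where
  skip       : ∀ {M} → Exec B skip M M 1
  store      : ∀ {M a e f k z s t} → Eval B M e (+ k) s → Eval B M f z t →
               Exec B (a ⟨ e ⟩≔ f) M (M [ a , k ]≔ z) (suc (s + t))
  seq        : ∀ {L M N p q s t} → Exec B p L M s → Exec B q M N t →
               Exec B (p ⨾ q) L N (s + t)
  if-pos     : ∀ {M N e p q z s t} → Eval B M e z s → 0ℤ <ℤ z →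
               Exec B p M N t → Exec B (ifPos e p q) M N (suc (s + t))
  if-nonpos  : ∀ {M N e p q z s t} → Eval B M e z s → z ≤ℤ 0ℤ →
               Exec B q M N t → Exec B (ifPos e p q) M N (suc (s + t))
  while-pos  : ∀ {L M N e p z r s t} → Eval B L e z r → 0ℤ <ℤ z →
               Exec B p L M s → Exec B (whilePos e p) M N t →
               Exec B (whilePos e p) L N (suc (r + (s + t)))
  while-stop : ∀ {M e p z s} → Eval B M e z s → z ≤ℤ 0ℤ →
               Exec B (whilePos e p) M M (suc s)

Eval-deterministic : ∀ {B M e x y s t} → Eval B M e x s → Eval B M e y t →
                     x ≡ y × s ≡ t
Eval-deterministic (lit _) (lit _) = refl , refl
Eval-deterministic (load p refl) (load q refl) with Eval-deterministic p q
... | refl , refl = refl , refl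
Eval-deterministic (add p p′ refl _) (add q q′ refl _)
  with Eval-deterministic p q | Eval-deterministic p′ q′
... | refl , refl | refl , refl = refl , refl
Eval-deterministic (sub p p′ refl _) (sub q q′ refl _)
  with Eval-deterministic p q | Eval-deterministic p′ q′
... | refl , refl | refl , refl = refl , refl

Exec-deterministic : ∀ {B p M N N′ s t} → Exec B p M N s → Exec B p M N′ t →
                     N ≡ N′ × s ≡ t
Exec-deterministic skip skip = refl , refl
Exec-deterministic (store p q) (store p′ q′)
  with Eval-deterministic p p′ | Eval-deterministic q q′
... | refl , refl | refl , refl = refl , refl
Exec-deterministic (seq p q) (seq p′ q′) with Exec-deterministic p p′
... | refl , refl with Exec-deterministic q q′
... | refl , refl = refl , refl
Exec-deterministic (if-pos e _ p) (if-pos e′ _ p′)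
  with Eval-deterministic e e′ | Exec-deterministic p p′
... | refl , refl | refl , refl = refl , refl
Exec-deterministic (if-pos e 0<z _) (if-nonpos e′ z≤0 _)
  with Eval-deterministic e e′
... | refl , refl = contradiction z≤0 (ℤₚ.<⇒≱ 0<z)
Exec-deterministic (if-nonpos e z≤0 _) (if-pos e′ 0<z _)
  with Eval-deterministic e e′
... | refl , refl = contradiction z≤0 (ℤₚ.<⇒≱ 0<z)
Exec-deterministic (if-nonpos e _ p) (if-nonpos e′ _ p′)
  with Eval-deterministic e e′ | Exec-deterministic p p′
... | refl , refl | refl , refl = refl , refl
Exec-deterministic (while-pos e _ p q) (while-pos e′ _ p′ q′)
  with Eval-deterministic e e′ | Exec-deterministic p p′
... | refl , refl | refl , refl with Exec-deterministic q q′
... | refl , refl = refl , refl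
Exec-deterministic (while-pos e 0<z _ _) (while-stop e′ z≤0)
  with Eval-deterministic e e′
... | refl , refl = contradiction z≤0 (ℤₚ.<⇒≱ 0<z)
Exec-deterministic (while-stop e z≤0) (while-pos e′ 0<z _ _)
  with Eval-deterministic e e′
... | refl , refl = contradiction z≤0 (ℤₚ.<⇒≱ 0<z)
Exec-deterministic (while-stop e _) (while-stop e′ _)
  with Eval-deterministic e e′
... | refl , refl = refl , refl

------------------------------------------------------------------------
-- Input and output

padded : ∀ {k} → (Fin k → ℤ) → ℕ → ℤ
padded {zero}  f _       = 0ℤ
padded {suc k} f zero    = f zero
padded {suc k} f (suc i) = padded (λ j → f (suc j)) i

module _ (G : GameGraph) where
  open GameGraph G

  private
    vertex : Fin n → ℤ
    vertex v = + toℕ v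

    player : Player → ℤ
    player alice = + 0
    player bob   = + 1

  -- n and m in array 0, the owners of the vertices in array 1, the sources,
  -- targets and weights of the edges in arrays 2, 3, 4, zero elsewhere.
  input : Memory
  input 0 0 = + n
  input 0 1 = + m
  input 1   = padded (λ v → player (owner v))
  input 2   = padded (λ e → vertex (proj₁ (edge e)))
  input 3   = padded (λ e → vertex (proj₂ (edge e)))
  input 4   = padded w
  input _ _ = 0ℤ

  -- With this bound words have O(log (n + m + W)) bits.
  wordBound : ℕ → ℕ
  wordBound d = d * (suc (n + m) * suc W)

outputArray : ℕ
outputArray = 5

-- -1 represents ∞.
encode : ℕ ⁺ → ℤ
encode [ x ] = + x
encode ⊤⁺    = -[1+ 0 ]

{-# OPTIONS --safe #-}
-- Let val k v be the energy that suffices for the first k moves from v, so that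
-- val (k + 1) v is the best value of max {0, val k u - w(v,u)} over the edges
-- from v.  If v grows in round k + 1, then some edge leads from v to a u that
-- grew in round k, with val (k + 1) v + w(v,u) ≤ val k u.  If a chain of such
-- edges visited a vertex twice, its later visit, which belongs to an earlier
-- round, would have the smaller value, so the cycle would have negative weight.
-- Hence nothing grows after n rounds, and n rounds of value iteration take
-- time O(mn).
--
-- At the fixed point Alice follows the optimal edges.  Bob at v plays the edge
-- that made v grow last.  Against him, the energy that is left never exceeds
-- what is needed, and where it equals it the round of last growth drops; so
-- again no vertex can repeat until the energy is exhausted.
module Submission where

open import Defs
open import Data.Bool using (true; false; T)
open import Data.Empty using (⊥-elim)
open import Data.Fin using (Fin; zero; suc; toℕ; fromℕ<)
import Data.Fin as Fin
import Data.Fin.Properties as Finₚ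
open import Data.Integer
  using (ℤ; +_; -[1+_]; 0ℤ; 1ℤ; -1ℤ; ∣_∣; -_; +≤+; +<+; nonNegative)
  renaming (_+_ to _+ℤ_; _-_ to _-ℤ_; _⊔_ to _⊔ℤ_; _≤_ to _≤ℤ_; _<_ to _<ℤ_)
import Data.Integer.Properties as ℤₚ
import Data.Integer.Tactic.RingSolver as ℤ-Solver
open import Data.List using (List; []; _∷_; filter; allFin)
open import Data.List.Extrema ℤₚ.≤-totalOrder
  using (argmin; argmax; argmin-all; argmax-all; f[argmin]≤f[xs]; f[xs]≤f[argmax])
open import Data.List.Membership.Propositional.Properties using (∈-allFin; ∈-filter⁺)
open import Data.List.Relation.Unary.All as All using (All; []; _∷_)
open import Data.List.Relation.Unary.All.Properties using (all-filter)
open import Data.List.Relation.Unary.AllPairs using ([]; _∷_)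
open import Data.List.Relation.Unary.Unique.Propositional using (Unique)
open import Data.Nat
  using (ℕ; zero; suc; _+_; _*_; _≤_; _<_; _≤′_; ≤′-refl; ≤′-step; z≤n; s≤s; >-nonZero; _≡ᵇ_)
import Data.Nat.Properties as ℕₚ
import Data.Nat.Tactic.RingSolver as ℕ-Solver
open import Data.Product using (Σ; ∃-syntax; _×_; _,_; proj₁; proj₂)
open import Data.Sum using (_⊎_; inj₁; inj₂)
open import Data.Unit using (tt)
open import Function using (_∘_; id; case_of_)
open import Relation.Binary.Construct.Add.Infimum.NonStrict _≤ℤ_ using (_≤₋_; ⊥₋≤_; [_])
open import Relation.Binary.Construct.Add.Supremum.NonStrict _≤_ using (_≤⁺_; _≤⊤⁺; [_]; ≤⁺-trans)
open import Relation.Binary.Definitions using (Transitive)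
open import Relation.Binary.PropositionalEquality
  using (_≡_; _≢_; refl; sym; trans; cong; subst; subst₂)
open import Relation.Nullary using (¬_; Dec; yes; no; contradiction)
open import Relation.Nullary.Construct.Add.Infimum using (⊥₋; [_])
open import Relation.Nullary.Construct.Add.Supremum using (⊤⁺; [_])

-- Inequalities between integers.

i-j≤k⇒i≤k+j : ∀ {i j k} → i -ℤ j ≤ℤ k → i ≤ℤ k +ℤ j
i-j≤k⇒i≤k+j {i} {j} {k} p = subst (_≤ℤ k +ℤ j) (lem i j) (ℤₚ.+-monoˡ-≤ j p)
  where
  lem : ∀ i j → (i -ℤ j) +ℤ j ≡ i
  lem = ℤ-Solver.solve-∀

i≤j-k⇒i+k≤j : ∀ {i j k} → i ≤ℤ j -ℤ k → i +ℤ k ≤ℤ j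
i≤j-k⇒i+k≤j {i} {j} {k} p = subst (i +ℤ k ≤ℤ_) (lem j k) (ℤₚ.+-monoˡ-≤ k p)
  where
  lem : ∀ j k → (j -ℤ k) +ℤ k ≡ j
  lem = ℤ-Solver.solve-∀

i-k<j-k⇒i<j : ∀ {i j} k → i -ℤ k <ℤ j -ℤ k → i <ℤ j
i-k<j-k⇒i<j k p = ℤₚ.≰⇒> λ q → ℤₚ.<⇒≱ p (ℤₚ.+-monoˡ-≤ (- k) q)

0<i≤0⊔j⇒i≤j : ∀ {i j} → 0ℤ <ℤ i → i ≤ℤ 0ℤ ⊔ℤ j → i ≤ℤ j
0<i≤0⊔j⇒i≤j {i} {j} 0<i i≤ with ℤₚ.≤-total 0ℤ j
... | inj₁ 0≤j = subst (i ≤ℤ_) (ℤₚ.i≤j⇒i⊔j≡j 0≤j) i≤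
... | inj₂ j≤0 = contradiction (subst (i ≤ℤ_) (ℤₚ.i≥j⇒i⊔j≡i j≤0) i≤) (ℤₚ.<⇒≱ 0<i)

0≤i+j⇒-i≤j : ∀ {i j} → 0ℤ ≤ℤ i +ℤ j → - i ≤ℤ j
0≤i+j⇒-i≤j {i} {j} p = subst₂ _≤ℤ_ (ℤₚ.+-identityʳ (- i)) (lem i j) (ℤₚ.+-monoʳ-≤ (- i) p)
  where
  lem : ∀ i j → - i +ℤ (i +ℤ j) ≡ j
  lem = ℤ-Solver.solve-∀

i+j≤0⇒j≤-i : ∀ {i j} → i +ℤ j ≤ℤ 0ℤ → j ≤ℤ - i
i+j≤0⇒j≤-i {i} {j} p = subst₂ _≤ℤ_ (lem i j) (ℤₚ.+-identityʳ (- i)) (ℤₚ.+-monoʳ-≤ (- i) p)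
  where
  lem : ∀ i j → - i +ℤ (i +ℤ j) ≡ j
  lem = ℤ-Solver.solve-∀

-- With `neg-max0`, turns bounds on an infimum `j` into bounds on the energy that `max0-` assigns to
-- it.
max0-neg : ∀ {i j} → 0ℤ ≤ℤ i → - i ≤ℤ j → ∣ 0ℤ ⊔ℤ - j ∣ ≤ ∣ i ∣
max0-neg {i} {j} 0≤i -i≤j = ℤₚ.drop‿+≤+ (subst₂ _≤ℤ_
  (sym (ℤₚ.0≤i⇒+∣i∣≡i (ℤₚ.i≤i⊔j 0ℤ (- j)))) (sym (ℤₚ.0≤i⇒+∣i∣≡i 0≤i))
  (ℤₚ.⊔-lub 0≤i (subst (- j ≤ℤ_) (ℤₚ.neg-involutive i) (ℤₚ.neg-mono-≤ -i≤j))))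

neg-max0 : ∀ {i j} → 0ℤ ≤ℤ i → j ≤ℤ - i → ∣ i ∣ ≤ ∣ 0ℤ ⊔ℤ - j ∣
neg-max0 {i} {j} 0≤i j≤-i = ℤₚ.drop‿+≤+ (subst₂ _≤ℤ_
  (sym (ℤₚ.0≤i⇒+∣i∣≡i 0≤i)) (sym (ℤₚ.0≤i⇒+∣i∣≡i (ℤₚ.i≤i⊔j 0ℤ (- j))))
  (ℤₚ.≤-trans (subst (_≤ℤ - j) (ℤₚ.neg-involutive i) (ℤₚ.neg-mono-≤ j≤-i)) (ℤₚ.i≤j⊔i 0ℤ (- j))))

∣i-j∣≤ : ∀ {i j b} → 0ℤ ≤ℤ i → 0ℤ ≤ℤ j → ∣ i ∣ ≤ b → ∣ j ∣ ≤ b → ∣ i -ℤ j ∣ ≤ b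
∣i-j∣≤ {+ p} {+ q} _ _ p≤b q≤b rewrite ℤₚ.m-n≡m⊖n p q =
  ℕₚ.≤-trans (ℤₚ.∣m⊝n∣≤m⊔n p q) (ℕₚ.⊔-lub p≤b q≤b)

∣0⊔i∣≤∣i∣ : ∀ i → ∣ 0ℤ ⊔ℤ i ∣ ≤ ∣ i ∣
∣0⊔i∣≤∣i∣ (+ k)    = ℕₚ.≤-refl
∣0⊔i∣≤∣i∣ -[1+ k ] = z≤n

-- Chains of a transitive relation and the pigeonhole principle.

data Chain {S : Set} (R : S → S → Set) : ℕ → S → Set where
  []  : ∀ {s} → Chain R zero s
  _∷_ : ∀ {k s t} → R s t → Chain R k t → Chain R (suc k) s

module _ {S : Set} {R : S → S → Set} where

  state : ∀ {k s} → Chain R k s → Fin (suc k) → S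
  state {s = s} _       zero    = s
  state         (_ ∷ c) (suc i) = state c i

  state-related : Transitive R → ∀ {k s} (c : Chain R k s) {i j} →
                  i Fin.< j → R (state c i) (state c j)
  state-related R-trans (r ∷ c) {zero} {suc zero}    _ = r
  state-related R-trans (r ∷ c@(_ ∷ _)) {zero} {suc (suc j)} _ =
    R-trans r (state-related R-trans c {zero} {suc j} (s≤s z≤n))
  state-related R-trans (r ∷ c) {suc i} {suc j} (s≤s i<j) = state-related R-trans c i<j

  -- The `suc n` states of the chain cannot all differ under `f`, and transitivity contracts the
  -- stretch between two that agree into a single forbidden step. States may carry more data than
  -- their image, so `irrefl` is demanded for equal images.
  no-long-chain : ∀ {n} → Transitive R → (f : S → Fin n) →
                  (∀ {s t} → f s ≡ f t → ¬ R s t) → ∀ {s} → ¬ Chain R n s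
  no-long-chain R-trans f irrefl c
    with i , j , i<j , eq ← Finₚ.pigeonhole ℕₚ.≤-refl (f ∘ state c) =
    irrefl eq (state-related R-trans c i<j)

-- Infima of integer sequences.

module Infimum (G : GameGraph) (f : ℕ → ℤ) where
  open Game G using (IsInfimum)

  minimum⇒infimum : ∀ {z} → (∀ i → z ≤ℤ f i) → ∃[ i ] f i ≤ℤ z → IsInfimum f [ z ]
  minimum⇒infimum lower (i , fi≤z) = (λ j → [ lower j ]) , greatest
    where
    greatest : ∀ y → (∀ i → y ≤₋ [ f i ]) → y ≤₋ [ _ ]
    greatest ⊥₋    _  = ⊥₋≤ _
    greatest [ y ] lb with lb i
    ... | [ y≤fi ] = [ ℤₚ.≤-trans y≤fi fi≤z ]

  -- Classically only, since boundedness from below is undecidable.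
  infimum-exists : ¬ ¬ (∃[ x ] IsInfimum f x)
  infimum-exists none = none (⊥₋ , (λ _ → ⊥₋≤ _) , only-⊥₋)
    where
    Lower : ℤ → Set
    Lower z = ∀ i → z ≤ℤ f i

    -- Integers are discrete: a lower bound whose successor is none would be the greatest one, hence
    -- an infimum, against `none`.
    raise : ∀ {z} → Lower z → ¬ ¬ Lower (1ℤ +ℤ z)
    raise {z} lower not-lower = none ([ z ] , (λ i → [ lower i ]) , greatest)
      where
      greatest : ∀ y → (∀ i → y ≤₋ [ f i ]) → y ≤₋ [ z ]
      greatest ⊥₋    _  = ⊥₋≤ _
      greatest [ y ] lb with ℤₚ._≤?_ y z
      ... | yes y≤z = [ y≤z ]
      ... | no  y≰z = ⊥-elim (not-lower λ i → ℤₚ.≤-trans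
              (ℤₚ.i<j⇒suc[i]≤j (ℤₚ.≰⇒> y≰z)) (case lb i of λ { [ y≤fi ] → y≤fi }))

    raise* : ∀ k {z} → Lower z → ¬ ¬ Lower (+ k +ℤ z)
    raise* zero    {z} lower k = k (subst Lower (sym (ℤₚ.+-identityˡ z)) lower)
    raise* (suc k) {z} lower c = raise* k lower λ l → raise l λ l′ →
      c (subst Lower (sym (ℤₚ.+-assoc 1ℤ (+ k) z)) l′)

    -- Enough raises push the lower bound to `1 + f 0`, above the value `f 0`.
    unbounded : ∀ z → ¬ Lower z
    unbounded z lower = raise* (suc ∣ f 0 -ℤ z ∣) lower λ l →
      ℤₚ.<⇒≱ (ℤₚ.suc[i]≤j⇒i<j (subst (_≤ℤ f 0) above (l 0))) ℤₚ.≤-refl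
      where
      sum≡ : ∀ a z → (1ℤ +ℤ (a -ℤ z)) +ℤ z ≡ 1ℤ +ℤ a
      sum≡ = ℤ-Solver.solve-∀
      above : + suc ∣ f 0 -ℤ z ∣ +ℤ z ≡ 1ℤ +ℤ f 0
      above = trans (cong (λ d → (1ℤ +ℤ d) +ℤ z) (ℤₚ.0≤i⇒+∣i∣≡i (ℤₚ.i≤j⇒0≤j-i (lower 0))))
                    (sum≡ (f 0) z)

    only-⊥₋ : ∀ y → (∀ i → y ≤₋ [ f i ]) → y ≤₋ ⊥₋
    only-⊥₋ ⊥₋    _  = ⊥₋≤ _
    only-⊥₋ [ y ] lb = ⊥-elim (unbounded y λ i → case lb i of λ { [ y≤fi ] → y≤fi })

-- Walks and the removal of cycles.

module Walks (G : GameGraph) where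
  open GameGraph G
  open Game G hiding (NoNegativeCycle; IsMinSufficientEnergy)

  infixr 5 _++_
  _++_ : ∀ {u v t} → Walk u v → Walk v t → Walk u t
  []      ++ q = q
  (e ∷ p) ++ q = e ∷ (p ++ q)

  weight-++ : ∀ {u v t} (p : Walk u v) (q : Walk v t) →
              weight (p ++ q) ≡ weight p +ℤ weight q
  weight-++ []            q = sym (ℤₚ.+-identityˡ _)
  weight-++ ((e , _) ∷ p) q =
    trans (cong (w e +ℤ_) (weight-++ p q)) (sym (ℤₚ.+-assoc (w e) _ _))

  ++-≤ : ∀ x {y z u v t} (p : Walk u v) (q : Walk v t) →
         x +ℤ weight p ≤ℤ y → y +ℤ weight q ≤ℤ z → x +ℤ weight (p ++ q) ≤ℤ z
  ++-≤ x {y} {z} p q xp≤y yq≤z = begin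
    x +ℤ weight (p ++ q)          ≡⟨ cong (x +ℤ_) (weight-++ p q) ⟩
    x +ℤ (weight p +ℤ weight q)   ≡⟨ ℤₚ.+-assoc x (weight p) (weight q) ⟨
    (x +ℤ weight p) +ℤ weight q   ≤⟨ ℤₚ.+-monoˡ-≤ (weight q) xp≤y ⟩
    y +ℤ weight q                 ≤⟨ yq≤z ⟩
    z                             ∎
    where open ℤₚ.≤-Reasoning

  -- The split of `p` at the first visit to `u`. The field `restrict` is what keeps `before` simple
  -- when `first-visit` prepends an edge to it.
  record FirstVisit {x v : V} (u : V) (p : Walk x v) : Set where
    field
      before    : Walk x u
      after     : Walk u v
      weight≡   : weight p ≡ weight before +ℤ weight after
      avoids    : All (u ≢_) (sources before)
      simple₁   : Unique (sources before)
      simple₂   : Unique (sources after)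
      restrict  : ∀ {y} → All (y ≢_) (sources p) → All (y ≢_) (sources before)

  first-visit : ∀ {x v} u (p : Walk x v) → Unique (sources p) →
                All (u ≢_) (sources p) ⊎ FirstVisit u p
  first-visit u [] _ = inj₁ []
  first-visit {x} u (f ∷ p) simple with u Finₚ.≟ x
  ... | yes refl = inj₂ record
          { before = [] ; after = f ∷ p ; weight≡ = sym (ℤₚ.+-identityˡ _)
          ; avoids = [] ; simple₁ = [] ; simple₂ = simple ; restrict = λ _ → [] }
  first-visit u (f@(e , _) ∷ p) (x∉ ∷ simple) | no u≢x with first-visit u p simple
  ... | inj₁ u∉ = inj₁ (u≢x ∷ u∉)
  ... | inj₂ fv = inj₂ record
          { before   = f ∷ before
          ; after    = after
          ; weight≡  = trans (cong (w e +ℤ_) weight≡) (sym (ℤₚ.+-assoc (w e) _ _))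
          ; avoids   = u≢x ∷ avoids
          ; simple₁  = restrict x∉ ∷ simple₁
          ; simple₂  = simple₂
          ; restrict = λ { (px ∷ ps) → px ∷ restrict ps }
          }
    where open FirstVisit fv

  sourceless⇒weightless : ∀ {u v} (p : Walk u v) → sources p ≡ [] → weight p ≡ 0ℤ
  sourceless⇒weightless [] _ = refl

  module _ (nonneg : NoNegativeCycle G) where

    -- An edge prepended to a walk that is already simple can only repeat its own source `u`. The
    -- part up to the first return to `u` is then a cycle, and dropping it does not raise the
    -- weight.
    simplify : ∀ {u v} (p : Walk u v) →
               Σ (Walk u v) λ q → Unique (sources q) × weight q ≤ℤ weight p
    simplify [] = [] , [] , ℤₚ.≤-refl
    simplify {u} (f@(e , _) ∷ p)
      with q , simple , q≤p ← simplify p with first-visit u q simple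
    ... | inj₁ u∉ = f ∷ q , u∉ ∷ simple , ℤₚ.+-monoʳ-≤ (w e) q≤p
    ... | inj₂ fv = after , simple₂ , (begin
          weight after                                   ≤⟨ ℤₚ.i≤j+i _ _ {{nonNegative cycle}} ⟩
          (w e +ℤ weight before) +ℤ weight after         ≡⟨ ℤₚ.+-assoc (w e) _ _ ⟩
          w e +ℤ (weight before +ℤ weight after)         ≡⟨ cong (w e +ℤ_) weight≡ ⟨
          w e +ℤ weight q                                ≤⟨ ℤₚ.+-monoʳ-≤ (w e) q≤p ⟩
          w e +ℤ weight p                                ∎)
      where
      open FirstVisit fv
      open ℤₚ.≤-Reasoning
      cycle : 0ℤ ≤ℤ w e +ℤ weight before
      cycle = nonneg (f ∷ before) ((λ ()) , avoids ∷ simple₁)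

    -- The hypothesis speaks of simple cycles only; simplifying a closed walk leaves such a cycle or
    -- the empty walk, and neither is heavier than the original.
    closed-walk-nonneg : ∀ {v} (p : Walk v v) → 0ℤ ≤ℤ weight p
    closed-walk-nonneg p with q , simple , q≤p ← simplify p with sources q in eq
    ... | []    = ℤₚ.≤-trans (ℤₚ.≤-reflexive (sym (sourceless⇒weightless q eq))) q≤p
    ... | _ ∷ _ = ℤₚ.≤-trans (nonneg q (nonempty , subst Unique (sym eq) simple)) q≤p
      where
      nonempty : sources q ≢ []
      nonempty eq′ with () ← trans (sym eq) eq′

-- Value iteration and the growth of values.

module Iteration (G : GameGraph) where
  open GameGraph G
  open Game G hiding (NoNegativeCycle; IsMinSufficientEnergy)

  src tgt : Fin m → V
  src e = proj₁ (edge e)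
  tgt e = proj₂ (edge e)

  follow : ∀ {v} e → src e ≡ v → E v (tgt e)
  follow e refl = e , refl

  follow-edge : ∀ {v} e (s : src e ≡ v) → proj₁ (follow e s) ≡ e
  follow-edge e refl = refl

  -- The least energy with which `e` can be crossed so that `g` is left at its target.
  relax : (V → ℤ) → Fin m → ℤ
  relax g e = 0ℤ ⊔ℤ (g (tgt e) -ℤ w e)

  Better : Player → ℤ → ℤ → Set
  Better alice x y = x ≤ℤ y
  Better bob   x y = y ≤ℤ x

  Better-refl : ∀ P {x} → Better P x x
  Better-refl alice = ℤₚ.≤-refl
  Better-refl bob   = ℤₚ.≤-refl

  Better-trans : ∀ P {x y z} → Better P x y → Better P y z → Better P x z
  Better-trans alice p q = ℤₚ.≤-trans p q
  Better-trans bob   p q = ℤₚ.≤-trans q p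

  Optimal : Player → (V → ℤ) → V → Fin m → Set
  Optimal P g v e =
    src e ≡ v × (∀ e′ → src e′ ≡ v → Better P (relax g e) (relax g e′))

  out-edges : V → List (Fin m)
  out-edges v = filter (λ e → src e Finₚ.≟ v) (allFin m)

  best : Player → (V → ℤ) → V → Fin m
  -- The default edge leaves `v` as well, so the choice is an edge from `v` in any case.
  best alice g v = argmin (relax g) (proj₁ (has-out-edge v)) (out-edges v)
  best bob   g v = argmax (relax g) (proj₁ (has-out-edge v)) (out-edges v)

  best-optimal : ∀ P g v → Optimal P g v (best P g v)
  best-optimal alice g v =
    argmin-all (relax g) {xs = out-edges v} (proj₂ (has-out-edge v))
      (all-filter (λ e → src e Finₚ.≟ v) (allFin m)) ,
    λ e′ s → All.lookup (f[argmin]≤f[xs] {f = relax g} _ (out-edges v))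
      (∈-filter⁺ (λ e → src e Finₚ.≟ v) (∈-allFin e′) s)
  best-optimal bob g v =
    argmax-all (relax g) {xs = out-edges v} (proj₂ (has-out-edge v))
      (all-filter (λ e → src e Finₚ.≟ v) (allFin m)) ,
    λ e′ s → All.lookup (f[xs]≤f[argmax] {f = relax g} _ (out-edges v))
      (∈-filter⁺ (λ e → src e Finₚ.≟ v) (∈-allFin e′) s)

  -- Ties may be broken differently by `best` and by the program; only the edge can depend on that.
  optimal-unique : ∀ P {g v e e′} → Optimal P g v e → Optimal P g v e′ →
                   relax g e ≡ relax g e′
  optimal-unique alice (s , opt) (s′ , opt′) = ℤₚ.≤-antisym (opt _ s′) (opt′ _ s)
  optimal-unique bob   (s , opt) (s′ , opt′) = ℤₚ.≤-antisym (opt′ _ s) (opt _ s′)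

  val : ℕ → V → ℤ
  val zero    v = 0ℤ
  val (suc k) v = relax (val k) (best (owner v) (val k) v)

  val-alice : ∀ k {v e} → owner v ≡ alice → src e ≡ v → val (suc k) v ≤ℤ relax (val k) e
  val-alice k {v} o s rewrite o = proj₂ (best-optimal alice (val k) v) _ s

  val-bob : ∀ k {v e} → owner v ≡ bob → src e ≡ v → relax (val k) e ≤ℤ val (suc k) v
  val-bob k {v} o s rewrite o = proj₂ (best-optimal bob (val k) v) _ s

  val-best : ∀ k {v P} → owner v ≡ P → val (suc k) v ≡ relax (val k) (best P (val k) v)
  val-best k refl = refl

  best-src : ∀ P g v → src (best P g v) ≡ v
  best-src P g v = proj₁ (best-optimal P g v)

  0≤relax : ∀ g e → 0ℤ ≤ℤ relax g e
  0≤relax g e = ℤₚ.i≤i⊔j 0ℤ (g (tgt e) -ℤ w e)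

  0≤val : ∀ k v → 0ℤ ≤ℤ val k v
  0≤val zero    v = ℤₚ.≤-refl
  0≤val (suc k) v = 0≤relax (val k) _

  relax-mono : ∀ {f g} → (∀ v → f v ≤ℤ g v) → ∀ e → relax f e ≤ℤ relax g e
  relax-mono f≤g e = ℤₚ.⊔-monoʳ-≤ 0ℤ (ℤₚ.+-monoˡ-≤ (- w e) (f≤g (tgt e)))

  -- For Alice the edge is the best one of round k, for Bob that of round suc k.
  val-step : ∀ k v → Σ (Fin m) λ e →
    src e ≡ v × relax (val k) e ≤ℤ val (suc k) v × val (suc (suc k)) v ≤ℤ relax (val (suc k)) e
  val-step k v = go (owner v) refl
    where
    go : ∀ P → owner v ≡ P → Σ (Fin m) λ e →
      src e ≡ v × relax (val k) e ≤ℤ val (suc k) v × val (suc (suc k)) v ≤ℤ relax (val (suc k)) e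
    go alice o = e , s , ℤₚ.≤-reflexive (sym (val-best k o)) , val-alice (suc k) o s
      where e = best alice (val k) v
            s = best-src alice (val k) v
    go bob   o = e , s , val-bob k o s , ℤₚ.≤-reflexive (val-best (suc k) o)
      where e = best bob (val (suc k)) v
            s = best-src bob (val (suc k)) v

  -- Rounds are monotone in the previous values, and the first starts from the least possible ones.
  -- The edge to compare along is the best of the later round for Alice and of the earlier round for
  -- Bob.
  val-mono-suc : ∀ k v → val k v ≤ℤ val (suc k) v
  val-mono-suc zero    v = 0≤val 1 v
  val-mono-suc (suc k) v = go (owner v) refl
    where
    go : ∀ P → owner v ≡ P → val (suc k) v ≤ℤ val (suc (suc k)) v
    go alice o = ℤₚ.≤-trans (val-alice k o (best-src alice (val (suc k)) v)) (ℤₚ.≤-trans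
      (relax-mono (val-mono-suc k) _) (ℤₚ.≤-reflexive (sym (val-best (suc k) o))))
    go bob   o = ℤₚ.≤-trans (ℤₚ.≤-reflexive (val-best k o)) (ℤₚ.≤-trans
      (relax-mono (val-mono-suc k) _) (val-bob (suc k) o (best-src bob (val k) v)))

  val-mono : ∀ {j k} → j ≤ k → ∀ v → val j v ≤ℤ val k v
  val-mono {j} j≤k v = go (ℕₚ.≤⇒≤′ j≤k)
    where
    go : ∀ {k} → j ≤′ k → val j v ≤ℤ val k v
    go ≤′-refl       = ℤₚ.≤-refl
    go {suc k} (≤′-step j≤k) = ℤₚ.≤-trans (go j≤k) (val-mono-suc k v)

  Grows : ℕ → V → Set
  Grows k v = val k v <ℤ val (suc k) v

  -- The edge of `val-step` bounds the old value of `v` from below and the new one from above, so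
  -- with the same weight on both sides the growth passes to its target.
  grows-back : ∀ k v → Grows (suc k) v → ∃[ u ] Σ (E v u) λ f →
    Grows k u × val (suc (suc k)) v +ℤ w (proj₁ f) ≤ℤ val (suc k) u
  grows-back k v grows with e , s , lower , upper ← val-step k v =
    tgt e , follow e s , i-k<j-k⇒i<j (w e) (begin-strict
      val k (tgt e) -ℤ w e       ≤⟨ ℤₚ.i≤j⊔i 0ℤ _ ⟩
      relax (val k) e            ≤⟨ lower ⟩
      val (suc k) v              <⟨ grows ⟩
      val (suc (suc k)) v        ≤⟨ upper′ ⟩
      val (suc k) (tgt e) -ℤ w e ∎) ,
    subst (λ d → val (suc (suc k)) v +ℤ d ≤ℤ val (suc k) (tgt e)) (cong w (sym (follow-edge e s)))
      (i≤j-k⇒i+k≤j upper′)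
    where
    open ℤₚ.≤-Reasoning
    upper′ : val (suc (suc k)) v ≤ℤ val (suc k) (tgt e) -ℤ w e
    -- A value that has just grown is positive, so the maximum with 0 in `relax` is not attained at
    -- 0 alone.
    upper′ = 0<i≤0⊔j⇒i≤j (ℤₚ.≤-<-trans (0≤val (suc k) v) grows) upper

-- Convergence within `n` rounds.

module Convergence (G : GameGraph) (nonneg : NoNegativeCycle G) where
  open GameGraph G
  open Game G hiding (NoNegativeCycle; IsMinSufficientEnergy)
  open Walks G
  open Iteration G

  private
    State : Set
    State = Σ ℕ λ k → Σ V (Grows k)

    -- The conclusion of `grows-back` extended from edges to walks, which makes it transitive.
    R : State → State → Set
    R (j , v , _) (k , u , _) =
      k < j × Σ (Walk v u) λ p → val (suc j) v +ℤ weight p ≤ℤ val (suc k) u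

    R-trans : Transitive R
    R-trans {j , v , _} (k<j , p , le) (l<k , q , le′) =
      ℕₚ.<-trans l<k k<j , p ++ q , ++-≤ (val (suc j) v) p q le le′

    -- Returning to `v` along a walk of nonnegative weight would bound `val (suc j) v` by its value
    -- after an earlier round, hence by `val j v`, although `v` grows in between.
    R-irrefl : ∀ {s t : State} → proj₁ (proj₂ s) ≡ proj₁ (proj₂ t) → ¬ R s t
    R-irrefl {j , v , grows} {k , _ , _} refl (k<j , p , le) = ℤₚ.<⇒≱ grows (begin
      val (suc j) v             ≤⟨ ℤₚ.i≤i+j _ _ {{nonNegative (closed-walk-nonneg nonneg p)}} ⟩
      val (suc j) v +ℤ weight p ≤⟨ le ⟩
      val (suc k) v             ≤⟨ val-mono k<j v ⟩
      val j v                   ∎)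
      where open ℤₚ.≤-Reasoning

    chain : ∀ k v (g : Grows k v) → Chain R k (k , v , g)
    chain zero    v g = []
    chain (suc k) v g with u , f , g′ , le ← grows-back k v g =
      (ℕₚ.≤-refl , f ∷ [] ,
        subst (λ d → val (suc (suc k)) v +ℤ d ≤ℤ val (suc k) u) (sym (ℤₚ.+-identityʳ _)) le)
      ∷ chain k u g′

  -- Growth at index `n` would start a chain of `n` steps, whose `n + 1` states lie over only `n`
  -- vertices.
  val-stable : ∀ v → val (suc n) v ≡ val n v
  val-stable v with ℤₚ._<?_ (val n v) (val (suc n) v)
  ... | yes g = ⊥-elim (no-long-chain {R = R} (λ {i} {j} {k} → R-trans {i} {j} {k})
                          (λ s → proj₁ (proj₂ s)) (λ {s} {t} → R-irrefl {s} {t}) (chain n v g))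
  ... | no ¬g = ℤₚ.≤-antisym (ℤₚ.≮⇒≥ ¬g) (val-mono-suc n v)

-- Optimal strategies at the fixed point.

module Optimality (G : GameGraph) (nonneg : NoNegativeCycle G) where
  open GameGraph G
  open Game G hiding (NoNegativeCycle; IsMinSufficientEnergy)
  open Walks G
  open Iteration G
  open Convergence G nonneg

  energy : V → ℤ
  energy = val n

  value : V → ℕ
  value v = ∣ energy v ∣

  +value≡energy : ∀ v → + value v ≡ energy v
  +value≡energy v = ℤₚ.0≤i⇒+∣i∣≡i (0≤val n v)

  σ* : Strategy alice
  σ* = record
    { move   = λ v _ → tgt (best alice energy v)
    ; isEdge = λ v _ → follow (best alice energy v) (best-src alice energy v) }

  last-growth : ∀ k v → val k v ≡ 0ℤ ⊎
                (∃[ j ] j < k × Grows j v × val (suc j) v ≡ val k v)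
  last-growth zero    v = inj₁ refl
  last-growth (suc k) v with ℤₚ._<?_ (val k v) (val (suc k) v)
  ... | yes g = inj₂ (k , ℕₚ.≤-refl , g , refl)
  ... | no ¬g with same ← ℤₚ.≤-antisym (val-mono-suc k v) (ℤₚ.≮⇒≥ ¬g) | last-growth k v
  ... | inj₁ zero≡              = inj₁ (trans (sym same) zero≡)
  ... | inj₂ (j , j<k , g , eq) = inj₂ (j , ℕₚ.m<n⇒m<1+n j<k , g , trans eq same)

  rank : V → ℕ
  rank v with last-growth n v
  -- A default for vertices of energy 0; ranks are compared only where the energy is positive.
  ... | inj₁ _       = 0
  ... | inj₂ (j , _) = j

  rank≤n : ∀ v → rank v ≤ n
  rank≤n v with last-growth n v
  ... | inj₁ _             = z≤n
  ... | inj₂ (_ , j<n , _) = ℕₚ.<⇒≤ j<n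

  rank-grows : ∀ v → 0ℤ <ℤ energy v → Grows (rank v) v × val (suc (rank v)) v ≡ energy v
  rank-grows v 0<e with last-growth n v
  ... | inj₁ zero≡   = contradiction (ℤₚ.≤-reflexive zero≡) (ℤₚ.<⇒≱ 0<e)
  ... | inj₂ (j , _ , p) = p

  -- Being optimal for `energy` alone would not do: a loop of weight 0 can be optimal and postpone
  -- the loss forever. The edge that caused the last growth rules this out.
  τ* : Strategy bob
  τ* = record
    { move   = λ v _ → tgt (best bob (val (rank v)) v)
    ; isEdge = λ v _ → follow (best bob (val (rank v)) v) (best-src bob (val (rank v)) v) }

  module AgainstBob (τ : Strategy bob) where
    open Play σ* τ

    -- The fixed point acts as a potential: by `val-stable`, Alice's edge attains the value of `v`
    -- and no edge of Bob exceeds it.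
    energy-step : ∀ v → energy (proj₁ (next v)) ≤ℤ energy v +ℤ w (proj₁ (proj₂ (next v)))
    energy-step v = go (owner v) refl
      where
      via : ∀ {u} (f : E v u) → relax energy (proj₁ f) ≤ℤ energy v →
            energy u ≤ℤ energy v +ℤ w (proj₁ f)
      via (e , refl) le = i-j≤k⇒i≤k+j (ℤₚ.≤-trans (ℤₚ.i≤j⊔i 0ℤ _) le)
      go : ∀ P (o : owner v ≡ P) → energy (proj₁ (chosen v P o)) ≤ℤ
           energy v +ℤ w (proj₁ (proj₂ (chosen v P o)))
      go alice o = via (Strategy.isEdge σ* v o) (subst (λ e → relax energy e ≤ℤ energy v)
        (sym (follow-edge (best alice energy v) (best-src alice energy v)))
        (ℤₚ.≤-reflexive (trans (sym (val-best n o)) (val-stable v))))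
      go bob   o with Strategy.isEdge τ v o
      ... | f@(e , eq) = via f (ℤₚ.≤-trans (val-bob n o (cong proj₁ eq))
              (ℤₚ.≤-reflexive (val-stable v)))

    energy-suffices : ∀ i s → 0ℤ ≤ℤ energy s +ℤ pathWeight s i
    energy-suffices zero    s = subst (0ℤ ≤ℤ_) (sym (ℤₚ.+-identityʳ _)) (0≤val n s)
    energy-suffices (suc i) s = ℤₚ.≤-trans (energy-suffices i (proj₁ (next s)))
      (subst (energy (proj₁ (next s)) +ℤ pathWeight (proj₁ (next s)) i ≤ℤ_) (ℤₚ.+-assoc (energy s) _ _)
        (ℤₚ.+-monoˡ-≤ (pathWeight (proj₁ (next s)) i) (energy-step s)))

  module AgainstAlice (σ : Strategy alice) where
    open Play σ τ*

    -- Bounding by the values at index `rank v`, and not by the final ones, records which successors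
    -- leave the inequality strict.
    rank-step : ∀ v → 0ℤ <ℤ energy v →
      energy v +ℤ w (proj₁ (proj₂ (next v))) ≤ℤ val (rank v) (proj₁ (next v))
    rank-step v 0<e = go (owner v) refl
      where
      energy≡ : val (suc (rank v)) v ≡ energy v
      energy≡ = proj₂ (rank-grows v 0<e)
      via : ∀ {u} (f : E v u) → val (suc (rank v)) v ≤ℤ relax (val (rank v)) (proj₁ f) →
            energy v +ℤ w (proj₁ f) ≤ℤ val (rank v) u
      via (e , refl) le = i≤j-k⇒i+k≤j (0<i≤0⊔j⇒i≤j 0<e
        (ℤₚ.≤-trans (ℤₚ.≤-reflexive (sym energy≡)) le))
      go : ∀ P (o : owner v ≡ P) → energy v +ℤ w (proj₁ (proj₂ (chosen v P o)))
           ≤ℤ val (rank v) (proj₁ (chosen v P o))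
      go alice o with Strategy.isEdge σ v o
      ... | f@(e , eq) = via f (val-alice (rank v) o (cong proj₁ eq))
      go bob   o = via (Strategy.isEdge τ* v o)
        (subst (λ e → val (suc (rank v)) v ≤ℤ relax (val (rank v)) e)
          (sym (follow-edge (best bob (val (rank v)) v) (best-src bob (val (rank v)) v)))
          (ℤₚ.≤-reflexive (val-best (rank v) o)))

    private
      -- A lexicographic descent: the energy left never exceeds what is required, and if it is not
      -- strictly less, the rank has dropped. On a closed walk the first alternative contradicts
      -- nonnegative weight, the second irreflexivity.
      R : V → V → Set
      R v u = Σ (Walk v u) λ p → energy v +ℤ weight p ≤ℤ energy u ×
        (energy v +ℤ weight p <ℤ energy u ⊎ rank u < rank v)

      R-trans : Transitive R
      R-trans {v} {u} {t} (p , le , s) (q , le′ , s′) =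
        p ++ q , ++-≤ (energy v) p q le le′ , strict s s′
        where
        assoc : energy v +ℤ weight (p ++ q) ≡ (energy v +ℤ weight p) +ℤ weight q
        assoc = trans (cong (energy v +ℤ_) (weight-++ p q))
                      (sym (ℤₚ.+-assoc (energy v) (weight p) (weight q)))
        strict : energy v +ℤ weight p <ℤ energy u ⊎ rank u < rank v →
                 energy u +ℤ weight q <ℤ energy t ⊎ rank t < rank u →
                 energy v +ℤ weight (p ++ q) <ℤ energy t ⊎ rank t < rank v
        strict (inj₁ lt) _ = inj₁ (subst (_<ℤ energy t) (sym assoc)
          (ℤₚ.<-≤-trans (ℤₚ.+-monoˡ-< (weight q) lt) le′))
        strict (inj₂ _) (inj₁ lt) = inj₁ (subst (_<ℤ energy t) (sym assoc)
          (ℤₚ.≤-<-trans (ℤₚ.+-monoˡ-≤ (weight q) le) lt))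
        strict (inj₂ lt) (inj₂ lt′) = inj₂ (ℕₚ.<-trans lt′ lt)

      R-irrefl : ∀ {v u} → v ≡ u → ¬ R v u
      R-irrefl refl (p , _ , inj₂ lt) = ℕₚ.<-irrefl refl lt
      R-irrefl {v} refl (p , _ , inj₁ lt) = ℤₚ.<⇒≱ lt
        (ℤₚ.i≤i+j (energy v) (weight p) {{nonNegative (closed-walk-nonneg nonneg p)}})

    -- Follows the play for up to `k` moves. Reaching a vertex of energy 0 means that the initial
    -- energy is used up; until then every move extends the chain.
    exhausts-or-chain : ∀ k v → 0ℤ <ℤ energy v →
      (∃[ i ] energy v +ℤ pathWeight v i ≤ℤ 0ℤ) ⊎ Chain R k v
    exhausts-or-chain zero    v 0<e = inj₂ []
    exhausts-or-chain (suc k) v 0<e with ℤₚ._<?_ 0ℤ (energy (proj₁ (next v)))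
    ... | no  0≮u = inj₁ (1 , (begin
            energy v +ℤ (w e +ℤ 0ℤ)  ≡⟨ cong (energy v +ℤ_) (ℤₚ.+-identityʳ (w e)) ⟩
            energy v +ℤ w e          ≤⟨ rank-step v 0<e ⟩
            val (rank v) u           ≤⟨ val-mono (rank≤n v) u ⟩
            energy u                 ≤⟨ ℤₚ.≮⇒≥ 0≮u ⟩
            0ℤ                       ∎))
      where
      open ℤₚ.≤-Reasoning
      u = proj₁ (next v)
      e = proj₁ (proj₂ (next v))
    ... | yes 0<u with exhausts-or-chain k (proj₁ (next v)) 0<u
    ...   | inj₁ (i , le) = inj₁ (suc i , (begin
            energy v +ℤ (w e +ℤ pathWeight u i) ≡⟨ ℤₚ.+-assoc (energy v) (w e) _ ⟨
            (energy v +ℤ w e) +ℤ pathWeight u i ≤⟨ ℤₚ.+-monoˡ-≤ (pathWeight u i) (rank-step v 0<e) ⟩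
            val (rank v) u +ℤ pathWeight u i    ≤⟨ ℤₚ.+-monoˡ-≤ (pathWeight u i) (val-mono (rank≤n v) u) ⟩
            energy u +ℤ pathWeight u i          ≤⟨ le ⟩
            0ℤ                                  ∎))
      where
      open ℤₚ.≤-Reasoning
      u = proj₁ (next v)
      e = proj₁ (proj₂ (next v))
    ...   | inj₂ c = inj₂ ((proj₂ (next v) ∷ [] ,
              ℤₚ.≤-trans step (val-mono (rank≤n v) u) , strict (ℕₚ._<?_ (rank u) (rank v))) ∷ c)
      where
      u = proj₁ (next v)
      e = proj₁ (proj₂ (next v))
      step : energy v +ℤ (w e +ℤ 0ℤ) ≤ℤ val (rank v) u
      step = subst (λ d → energy v +ℤ d ≤ℤ val (rank v) u) (sym (ℤₚ.+-identityʳ (w e)))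
                   (rank-step v 0<e)
      strict : Dec (rank u < rank v) →
               energy v +ℤ (w e +ℤ 0ℤ) <ℤ energy u ⊎ rank u < rank v
      strict (yes lt) = inj₂ lt
      -- Here `u` still grows at an index not below `rank v`, so its final value is above the one in
      -- `step`.
      strict (no ¬lt) = inj₁ (ℤₚ.≤-<-trans step (ℤₚ.≤-<-trans (val-mono (ℕₚ.≮⇒≥ ¬lt) u)
        (subst (val (rank u) u <ℤ_) (proj₂ (rank-grows u 0<u)) (proj₁ (rank-grows u 0<u)))))

    exhausts : ∀ s → ∃[ i ] energy s +ℤ pathWeight s i ≤ℤ 0ℤ
    exhausts s with ℤₚ._<?_ 0ℤ (energy s)
    ... | no  0≮e = 0 , subst (_≤ℤ 0ℤ) (sym (ℤₚ.+-identityʳ (energy s))) (ℤₚ.≮⇒≥ 0≮e)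
    ... | yes 0<e with exhausts-or-chain n s 0<e
    ...   | inj₁ exhausted = exhausted
    ...   | inj₂ c         = ⊥-elim (no-long-chain R-trans id R-irrefl c)

  σ*-bound : ∀ τ s y → IsEnergy σ* τ s y → y ≤⁺ [ value s ]
  σ*-bound τ s _ (⊥₋ , (_ , greatest) , refl)
    with () ← greatest [ - energy s ] (λ i → [ 0≤i+j⇒-i≤j (AgainstBob.energy-suffices τ i s) ])
  σ*-bound τ s _ ([ z ] , (_ , greatest) , refl)
    with [ le ] ← greatest [ - energy s ] (λ i → [ 0≤i+j⇒-i≤j (AgainstBob.energy-suffices τ i s) ]) =
    [ max0-neg (0≤val n s) le ]

  τ*-bound : ∀ σ s y → IsEnergy σ τ* s y → [ value s ] ≤⁺ y
  τ*-bound σ s _ (⊥₋    , _ , refl)           = _ ≤⊤⁺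
  τ*-bound σ s _ ([ z ] , (lower , _) , refl)
    with i , le ← AgainstAlice.exhausts σ s with [ z≤ ] ← lower i =
    [ neg-max0 (0≤val n s) (ℤₚ.≤-trans z≤ (i+j≤0⇒j≤-i le)) ]

  σ*τ*-energy : ∀ s → IsEnergy σ* τ* s [ value s ]
  σ*τ*-energy s with i , le ← AgainstAlice.exhausts σ* s =
    [ - energy s ] ,
    minimum⇒infimum (λ i → 0≤i+j⇒-i≤j (AgainstBob.energy-suffices τ* i s)) (i , i+j≤0⇒j≤-i le) ,
    cong [_] (ℕₚ.≤-antisym (neg-max0 (0≤val n s) ℤₚ.≤-refl) (max0-neg (0≤val n s) ℤₚ.≤-refl))
    where open Infimum G (Play.pathWeight σ* τ* s)

  value-optimal : ∀ s → IsMinSufficientEnergy G s [ value s ]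
  value-optimal s = (σ* , (τ* , σ*τ*-energy s) , λ τ y → σ*-bound τ s y) , minimal
    where
    minimal : ∀ σ y → IsMaxEnergy σ s y → [ value s ] ≤⁺ y
    minimal σ ⊤⁺    _ = _ ≤⊤⁺
    minimal σ [ y ] (_ , maximal) with ℕₚ._≤?_ (value s) y
    ... | yes le = [ le ]
    -- The infimum against `τ*` exists only up to double negation; deciding the inequality first has
    -- made the goal a contradiction, where this suffices.
    ... | no ¬le = ⊥-elim (Infimum.infimum-exists G (Play.pathWeight σ τ* s) λ (x , inf) →
            ¬le (case ≤⁺-trans ℕₚ.≤-trans (τ*-bound σ s _ (x , inf , refl))
                                       (maximal τ* _ (x , inf , refl))
                 of λ { [ le ] → le }))

-- Array accesses and counted loops.

≡ᵇ-refl : ∀ k → (k ≡ᵇ k) ≡ true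
≡ᵇ-refl zero    = refl
≡ᵇ-refl (suc k) = ≡ᵇ-refl k

≢⇒≡ᵇ-false : ∀ {k l} → k ≢ l → (k ≡ᵇ l) ≡ false
≢⇒≡ᵇ-false {k} {l} k≢l with k ≡ᵇ l in eq
... | false = refl
... | true  = contradiction (ℕₚ.≡ᵇ⇒≡ k l (subst T (sym eq) tt)) k≢l

read-same : ∀ M a k z → (M [ a , k ]≔ z) a k ≡ z
read-same M a k z rewrite ≡ᵇ-refl a | ≡ᵇ-refl k = refl

read-other : ∀ M a {k l} z → k ≢ l → (M [ a , k ]≔ z) a l ≡ M a l
read-other M a z k≢l rewrite ≡ᵇ-refl a | ≢⇒≡ᵇ-false k≢l = refl

var : ℕ → Expr
var a = a ⟨ lit 0ℤ ⟩

-- The decrement precedes the body, so that the body sees the counter run down to 0 from one below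
-- the initial value and can use it as an index.
for : ℕ → Expr → Program → Program
for a init body =
  a ⟨ lit 0ℤ ⟩≔ init ⨾
  whilePos (var a) (a ⟨ lit 0ℤ ⟩≔ (var a ⊖ lit 1ℤ) ⨾ body)

module Machine (B : ℕ) (1≤B : 1 ≤ B) where

  -- A Hoare triple for total correctness, with `T` bounding the time.
  Runs : Program → Memory → ℕ → (Memory → Set) → Set
  Runs p M T Q = ∃[ N ] ∃[ t ] Exec B p M N t × t ≤ T × Q N

  seq-runs : ∀ {p q M S T P Q} → Runs p M S P → (∀ N → P N → Runs q N T Q) →
             Runs (p ⨾ q) M (S + T) Q
  seq-runs (N , s , ex , s≤S , pN) k with L , t , ex′ , t≤T , qL ← k N pN =
    L , s + t , seq ex ex′ , ℕₚ.+-mono-≤ s≤S t≤T , qL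

  eval-var : ∀ {M a z} → M a 0 ≡ z → Eval B M (var a) z 2
  eval-var eq = load (lit z≤n) (sym eq)

  module Countdown
    (a K : ℕ) (K≤B : K ≤ B) (body : Program) (T : ℕ) (Inv : ℕ → Memory → Set)
    (stable : ∀ j M z → Inv j M → Inv j (M [ a , 0 ]≔ z))
    (step : ∀ j M → j < K → M a 0 ≡ + j → Inv (suc j) M →
            Runs body M T (λ N → N a 0 ≡ + j × Inv j N))
    where

    -- In an iteration the test costs 3 and the decrement 6, which makes 9 besides the body; the
    -- final failing test gives the summand 3.
    loop-runs : ∀ k M → k ≤ K → M a 0 ≡ + k → Inv k M →
      Runs (whilePos (var a) (a ⟨ lit 0ℤ ⟩≔ (var a ⊖ lit 1ℤ) ⨾ body)) M (k * (9 + T) + 3) (Inv 0)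
    loop-runs zero M _ eq inv =
      M , 3 , while-stop (eval-var eq) (+≤+ z≤n) , ℕₚ.≤-refl , inv
    loop-runs (suc k) M k<K eq inv
      with N , s , ex , s≤T , eqN , invN ← step k (M [ a , 0 ]≔ (+ k)) k<K
             (read-same M a 0 (+ k)) (stable (suc k) M (+ k) inv)
      with L , t , ex′ , t≤ , invL ← loop-runs k N (ℕₚ.<⇒≤ k<K) eqN invN =
      L , _ ,
      while-pos (eval-var eq) (+<+ (s≤s z≤n))
        (seq (store (lit z≤n) (sub (eval-var eq) (lit 1≤B) refl
          (ℕₚ.≤-trans (ℕₚ.<⇒≤ k<K) K≤B))) ex) ex′ ,
      subst (9 + (s + t) ≤_) (sym (ℕₚ.+-assoc (9 + T) (k * (9 + T)) 3))
        (ℕₚ.+-monoʳ-≤ 9 (ℕₚ.+-mono-≤ s≤T t≤)) ,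
      invL

    for-runs : ∀ {M init s} → Eval B M init (+ K) s → Inv K M →
               Runs (for a init body) M (suc (1 + s) + (K * (9 + T) + 3)) (Inv 0)
    for-runs {M} ev inv = seq-runs {P = λ N → N a 0 ≡ + K × Inv K N}
      (_ , _ , store (lit z≤n) ev , ℕₚ.≤-refl , read-same M a 0 (+ K) , stable K M (+ K) inv)
      (λ N (eq , inv′) → loop-runs K N ℕₚ.≤-refl eq inv′)

-- The program for value iteration.

-- Array 5 holds the values of the current round, with -1 as a placeholder until
-- the first edge of a vertex is met, and array 6 those of the previous round.
-- Arrays 7 and 8 hold the counters of the outer and inner loops, and array 9
-- the relaxation of the current edge.
shiftVertex computeRelaxation clampRelaxation storeRelaxation : Program
improveValue relaxEdge valueIteration : Program

shiftVertex =
  6 ⟨ var 8 ⟩≔ (5 ⟨ var 8 ⟩) ⨾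
  5 ⟨ var 8 ⟩≔ lit -1ℤ

computeRelaxation = 9 ⟨ lit 0ℤ ⟩≔ (6 ⟨ 3 ⟨ var 8 ⟩ ⟩ ⊖ 4 ⟨ var 8 ⟩)

clampRelaxation = ifPos (var 9) skip (9 ⟨ lit 0ℤ ⟩≔ lit 0ℤ)

storeRelaxation = 5 ⟨ 2 ⟨ var 8 ⟩ ⟩≔ var 9

improveValue =
  -- Relaxations are nonnegative, so this test fails on the placeholder only. The next one succeeds
  -- for Bob, coded by 1, who keeps the larger value.
  ifPos (5 ⟨ 2 ⟨ var 8 ⟩ ⟩ ⊕ lit 1ℤ)
    (ifPos (1 ⟨ 2 ⟨ var 8 ⟩ ⟩)
      (ifPos (var 9 ⊖ 5 ⟨ 2 ⟨ var 8 ⟩ ⟩) storeRelaxation skip)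
      (ifPos (5 ⟨ 2 ⟨ var 8 ⟩ ⟩ ⊖ var 9) storeRelaxation skip))
    storeRelaxation

relaxEdge = computeRelaxation ⨾ clampRelaxation ⨾ improveValue

valueIteration =
  for 7 (0 ⟨ lit 0ℤ ⟩)
    (for 8 (0 ⟨ lit 0ℤ ⟩) shiftVertex ⨾
     for 8 (0 ⟨ lit 1ℤ ⟩) relaxEdge)

padded-toℕ : ∀ {k} (f : Fin k → ℤ) i → padded f (toℕ i) ≡ f i
padded-toℕ f zero    = refl
padded-toℕ f (suc i) = padded-toℕ (f ∘ suc) i

-- The running time.

module Cost (G : GameGraph) where
  open GameGraph G

  -- 19 = 9 + 10 and 51 = 9 + 42: a loop iteration costs 9 steps besides its body.
  roundCost : ℕ
  roundCost = (4 + (n * 19 + 3)) + (4 + (m * 51 + 3))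

  n≤m : n ≤ m
  n≤m = Finₚ.injective⇒≤ {f = proj₁ ∘ has-out-edge} λ {u} {v} eq →
    trans (sym (proj₂ (has-out-edge u))) (trans (cong (proj₁ ∘ edge) eq) (proj₂ (has-out-edge v)))

  n≤m*n : n ≤ m * n
  n≤m*n = go n n≤m
    where
    go : ∀ n → n ≤ m → n ≤ m * n
    go zero    _   = z≤n
    go (suc n) n<m = ℕₚ.m≤n*m (suc n) m {{>-nonZero (ℕₚ.≤-trans (s≤s z≤n) n<m)}}

  -- By `n≤m` the linear and quadratic terms in `n` are absorbed by `m * n`, giving 93 = 23 + 19 +
  -- 51. The summand 1 pays for the constant 7, which remains even for the empty graph.
  cost-bound : 4 + (n * (9 + roundCost) + 3) ≤ 93 * (m * n + 1)
  cost-bound = begin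
    4 + (n * (9 + roundCost) + 3)                                 ≡⟨ expand n m ⟩
    (23 * n + 19 * (n * n) + 51 * (m * n)) + 7                    ≤⟨ ℕₚ.+-mono-≤
      (ℕₚ.+-monoˡ-≤ (51 * (m * n)) (ℕₚ.+-mono-≤ (ℕₚ.*-monoʳ-≤ 23 n≤m*n)
        (ℕₚ.*-monoʳ-≤ 19 (ℕₚ.*-monoˡ-≤ n n≤m)))) (ℕₚ.≤ᵇ⇒≤ 7 93 tt) ⟩
    (23 * (m * n) + 19 * (m * n) + 51 * (m * n)) + 93             ≡⟨ collect (m * n) ⟩
    93 * (m * n + 1)                                              ∎
    where
    open ℕₚ.≤-Reasoning
    expand : ∀ n m → 4 + (n * (9 + ((4 + (n * 19 + 3)) + (4 + (m * 51 + 3)))) + 3) ≡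
             (23 * n + 19 * (n * n) + 51 * (m * n)) + 7
    expand = ℕ-Solver.solve-∀
    collect : ∀ k → (23 * k + 19 * k + 51 * k) + 93 ≡ 93 * (k + 1)
    collect = ℕ-Solver.solve-∀

-- Correctness of the program.

module Correctness (G : GameGraph) (B : ℕ)
  (n≤B : GameGraph.n G ≤ B) (m≤B : GameGraph.m G ≤ B)
  (values≤B : suc (GameGraph.n G * GameGraph.W G) ≤ B) where
  open GameGraph G
  open Iteration G
  open Cost G

  1≤B : 1 ≤ B
  1≤B = ℕₚ.≤-trans (s≤s z≤n) values≤B

  open Machine B 1≤B

  player : Player → ℤ
  player alice = 0ℤ
  player bob   = 1ℤ

  HoldsInput : Memory → Set
  HoldsInput M =
    M 0 0 ≡ + n × M 0 1 ≡ + m ×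
    (∀ v → M 1 (toℕ v) ≡ player (owner v)) ×
    (∀ e → M 2 (toℕ e) ≡ + toℕ (src e)) ×
    (∀ e → M 3 (toℕ e) ≡ + toℕ (tgt e)) ×
    (∀ e → M 4 (toℕ e) ≡ w e)

  -- The function coding players is private to Defs, so its value is only
  -- accessible through unification with the input.
  owner-input : ∀ v → ∃[ z ] input G 1 (toℕ v) ≡ z
  owner-input v = _ , padded-toℕ {n} _ v

  owner-input≡player : ∀ v → proj₁ (owner-input v) ≡ player (owner v)
  owner-input≡player v with owner v
  ... | alice = refl
  ... | bob   = refl

  input-holds-input : HoldsInput (input G)
  input-holds-input = refl , refl ,
    (λ v → trans (proj₂ (owner-input v)) (owner-input≡player v)) ,
    padded-toℕ {m} _ , padded-toℕ {m} _ , padded-toℕ {m} _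

  relax-difference-bound : ∀ (g : Fin n → ℤ) {R} → (∀ v → ∣ g v ∣ ≤ R) →
                           ∀ e → ∣ g (tgt e) -ℤ w e ∣ ≤ W + R
  relax-difference-bound g {R} ∣g∣≤R e = ℕₚ.≤-trans (ℤₚ.∣i-j∣≤∣i∣+∣j∣ (g (tgt e)) (w e))
    (subst (∣ g (tgt e) ∣ + ∣ w e ∣ ≤_) (ℕₚ.+-comm R W) (ℕₚ.+-mono-≤ (∣g∣≤R (tgt e)) (w-bounded e)))

  relax-bound : ∀ (g : Fin n → ℤ) {R} → (∀ v → ∣ g v ∣ ≤ R) → ∀ e → ∣ relax g e ∣ ≤ W + R
  relax-bound g ∣g∣≤R e = ℕₚ.≤-trans (∣0⊔i∣≤∣i∣ (g (tgt e) -ℤ w e))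
    (relax-difference-bound g ∣g∣≤R e)

  val-bound : ∀ k v → ∣ val k v ∣ ≤ k * W
  val-bound zero    v = z≤n
  val-bound (suc k) v = relax-bound (val k) (val-bound k) _

  module Round (r : ℤ) (i : ℕ) (i<n : i < n) where

    g : Fin n → ℤ
    g = val i

    -- The loop runs downwards, so the vertices from `k` on are the ones already treated.
    Shifted : ℕ → Memory → Set
    Shifted k M = M 7 0 ≡ r × HoldsInput M ×
      (∀ v → toℕ v < k → M 5 (toℕ v) ≡ g v) ×
      (∀ v → k ≤ toℕ v → M 6 (toℕ v) ≡ g v × M 5 (toℕ v) ≡ -1ℤ)

    shift-step : ∀ j M → j < n → M 8 0 ≡ + j → Shifted (suc j) M →
                 Runs shiftVertex M 10 (λ N → N 8 0 ≡ + j × Shifted j N)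
    shift-step j M j<n c≡ (r≡ , inp , todo , done) =
      _ , 10 ,
      seq (store (eval-var c≡) (load (eval-var c≡) refl)) (store (eval-var c≡) (lit 1≤B)) ,
      ℕₚ.≤-refl , c≡ , r≡ , inp , todo′ , done′
      where
      M′ : Memory
      M′ = M [ 6 , j ]≔ M 5 j
      todo′ : ∀ v → toℕ v < j → (M′ [ 5 , j ]≔ -1ℤ) 5 (toℕ v) ≡ g v
      todo′ v v<j = trans (read-other M′ 5 -1ℤ (ℕₚ.<⇒≢ v<j ∘ sym)) (todo v (ℕₚ.m<n⇒m<1+n v<j))
      done′ : ∀ v → j ≤ toℕ v →
              (M′ [ 5 , j ]≔ -1ℤ) 6 (toℕ v) ≡ g v × (M′ [ 5 , j ]≔ -1ℤ) 5 (toℕ v) ≡ -1ℤ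
      done′ v j≤v with ℕₚ.m≤n⇒m<n∨m≡n j≤v
      ... | inj₂ refl = trans (read-same M 6 j (M 5 j)) (todo v ℕₚ.≤-refl) , read-same M′ 5 j -1ℤ
      ... | inj₁ j<v  = trans (read-other M 6 (M 5 j) (ℕₚ.<⇒≢ j<v)) (proj₁ (done v j<v)) ,
                        trans (read-other M′ 5 -1ℤ (ℕₚ.<⇒≢ j<v)) (proj₂ (done v j<v))

    -- The state of one entry of array 5 when exactly the edges numbered `k` or more have been
    -- scanned: still the placeholder, or optimal among those edges.
    Relaxed : ℕ → Fin n → ℤ → Set
    Relaxed k v z =
      (z ≡ -1ℤ × (∀ e → k ≤ toℕ e → src e ≢ v)) ⊎
      (Σ (Fin m) λ e → z ≡ relax g e × src e ≡ v ×
        (∀ e′ → k ≤ toℕ e′ → src e′ ≡ v → Better (owner v) (relax g e) (relax g e′)))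

    Scanned : ℕ → Memory → Set
    Scanned k M = M 7 0 ≡ r × HoldsInput M ×
      (∀ v → M 6 (toℕ v) ≡ g v) × (∀ v → Relaxed k v (M 5 (toℕ v)))

    start-scan : ∀ M → Shifted 0 M → Scanned m M
    start-scan M (r≡ , inp , _ , done) = r≡ , inp , (λ v → proj₁ (done v z≤n)) ,
      λ v → inj₁ (proj₂ (done v z≤n) , λ e m≤e → contradiction m≤e (ℕₚ.<⇒≱ (Finₚ.toℕ<n e)))

    -- After all edges the placeholder is gone, since every vertex has an outgoing edge. The edge
    -- found may differ from `best`, but by `optimal-unique` its relaxation does not.
    end-scan : ∀ M → Scanned 0 M → ∀ v → M 5 (toℕ v) ≡ val (suc i) v
    end-scan M (_ , _ , _ , relaxed) v with relaxed v
    ... | inj₁ (_ , none) = contradiction (proj₂ (has-out-edge v)) (none _ z≤n)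
    ... | inj₂ (e , z≡ , s , opt) = trans z≡ (optimal-unique (owner v) {g}
            (s , λ e′ → opt e′ z≤n) (best-optimal (owner v) g v))

    -- The outer `suc` leaves room for the program's test whether a value plus 1 is positive.
    round≤B : suc (suc i * W) ≤ B
    round≤B = ℕₚ.≤-trans (s≤s (ℕₚ.*-monoˡ-≤ W i<n)) values≤B

    relax≤B : ∀ e → suc ∣ relax g e ∣ ≤ B
    relax≤B e = ℕₚ.≤-trans (s≤s (relax-bound g (val-bound i) e)) round≤B

    module _ (e : Fin m) where

      j : ℕ
      j = toℕ e

      u : Fin n
      u = src e

      Ready : Memory → Set
      Ready M = M 8 0 ≡ + j × Scanned (suc j) M

      compute-runs : ∀ M → Ready M →
        Runs computeRelaxation M 10 (λ N → Ready N × N 9 0 ≡ g (tgt e) -ℤ w e)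
      compute-runs M (c≡ , r≡ , inp@(_ , _ , _ , _ , tgt≡ , w≡) , old , new) =
        _ , 10 ,
        store (lit z≤n) (sub
          (load (load (eval-var c≡) (sym (tgt≡ e))) (sym (old (tgt e))))
          (load (eval-var c≡) (sym (w≡ e))) refl
          (ℕₚ.≤-trans (relax-difference-bound g (val-bound i) e)
            (ℕₚ.≤-trans (ℕₚ.n≤1+n _) round≤B))) ,
        ℕₚ.≤-refl , (c≡ , r≡ , inp , old , new) , refl

      clamp-runs : ∀ M → Ready M × M 9 0 ≡ g (tgt e) -ℤ w e →
        Runs clampRelaxation M 6 (λ N → Ready N × N 9 0 ≡ relax g e)
      clamp-runs M (ready , x≡) with ℤₚ._<?_ 0ℤ (g (tgt e) -ℤ w e)
      ... | yes 0<x = _ , _ , if-pos (eval-var x≡) 0<x skip , ℕₚ.≤ᵇ⇒≤ 4 6 tt ,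
                      ready , trans x≡ (sym (ℤₚ.i≤j⇒i⊔j≡j (ℤₚ.<⇒≤ 0<x)))
      ... | no  0≮x = _ , _ ,
                      if-nonpos (eval-var x≡) (ℤₚ.≮⇒≥ 0≮x) (store (lit z≤n) (lit z≤n)) , ℕₚ.≤-refl ,
                      ready , sym (ℤₚ.i≥j⇒i⊔j≡i (ℤₚ.≮⇒≥ 0≮x))

      current-or-later : ∀ {e′} → j ≤ toℕ e′ → e′ ≡ e ⊎ suc j ≤ toℕ e′
      current-or-later j≤e′ with ℕₚ.m≤n⇒m<n∨m≡n j≤e′
      ... | inj₁ j<e′ = inj₂ j<e′
      ... | inj₂ j≡e′ = inj₁ (Finₚ.toℕ-injective (sym j≡e′))

      relaxed-elsewhere : ∀ {v z} → u ≢ v → Relaxed (suc j) v z → Relaxed j v z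
      relaxed-elsewhere u≢v (inj₁ (z≡ , none)) = inj₁ (z≡ , λ e′ j≤e′ s → case current-or-later j≤e′ of λ
        { (inj₁ refl) → u≢v s ; (inj₂ j<e′) → none e′ j<e′ s })
      relaxed-elsewhere u≢v (inj₂ (b , z≡ , s , opt)) = inj₂ (b , z≡ , s , λ e′ j≤e′ s′ →
        case current-or-later j≤e′ of λ
        { (inj₁ refl) → contradiction s′ u≢v ; (inj₂ j<e′) → opt e′ j<e′ s′ })

      relaxed-first : (∀ e′ → suc j ≤ toℕ e′ → src e′ ≢ u) → Relaxed j u (relax g e)
      relaxed-first none = inj₂ (e , refl , refl , λ e′ j≤e′ s → case current-or-later j≤e′ of λ
        { (inj₁ refl) → Better-refl (owner u) ; (inj₂ j<e′) → contradiction s (none e′ j<e′) })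

      module _ {b : Fin m} (b-src : src b ≡ u) (b-opt : ∀ e′ → suc j ≤ toℕ e′ → src e′ ≡ u →
                Better (owner u) (relax g b) (relax g e′)) where

        relaxed-replace : Better (owner u) (relax g e) (relax g b) → Relaxed j u (relax g e)
        relaxed-replace better = inj₂ (e , refl , refl , λ e′ j≤e′ s → case current-or-later j≤e′ of λ
          { (inj₁ refl) → Better-refl (owner u)
          ; (inj₂ j<e′) → Better-trans (owner u) better (b-opt e′ j<e′ s) })

        relaxed-keep : Better (owner u) (relax g b) (relax g e) → Relaxed j u (relax g b)
        relaxed-keep better = inj₂ (b , refl , b-src , λ e′ j≤e′ s → case current-or-later j≤e′ of λ
          { (inj₁ refl) → better ; (inj₂ j<e′) → b-opt e′ j<e′ s })

      Done : Memory → Set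
      Done N = N 8 0 ≡ + j × Scanned j N

      module Improve (M : Memory) (ready : Ready M) (x≡ : M 9 0 ≡ relax g e) where

        c≡ : M 8 0 ≡ + j
        c≡ = proj₁ ready

        new : ∀ v → Relaxed (suc j) v (M 5 (toℕ v))
        new = proj₂ (proj₂ (proj₂ (proj₂ ready)))

        src≡ : M 2 j ≡ + toℕ u
        src≡ = let _ , _ , (_ , _ , _ , src≡ , _) , _ = ready in src≡ e

        owner≡ : M 1 (toℕ u) ≡ player (owner u)
        owner≡ = let _ , _ , (_ , _ , owner≡ , _) , _ = ready in owner≡ u

        eval-source : Eval B M (2 ⟨ var 8 ⟩) (+ toℕ u) 3
        eval-source = load (eval-var c≡) (sym src≡)

        eval-value : ∀ {z} → M 5 (toℕ u) ≡ z → Eval B M (5 ⟨ 2 ⟨ var 8 ⟩ ⟩) z 4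
        eval-value z≡ = load eval-source (sym z≡)

        eval-owner : ∀ {P} → owner u ≡ P → Eval B M (1 ⟨ 2 ⟨ var 8 ⟩ ⟩) (player P) 4
        eval-owner refl = load eval-source (sym owner≡)

        store-exec : Exec B storeRelaxation M (M [ 5 , toℕ u ]≔ relax g e) 6
        store-exec = store eval-source (eval-var x≡)

        stored : Relaxed j u (relax g e) → Done (M [ 5 , toℕ u ]≔ relax g e)
        stored rel = let c≡ , r≡ , inp , old , _ = ready in c≡ , r≡ , inp , old , new′
          where
          new′ : ∀ v → Relaxed j v ((M [ 5 , toℕ u ]≔ relax g e) 5 (toℕ v))
          new′ v with u Finₚ.≟ v
          ... | yes refl = subst (Relaxed j u) (sym (read-same M 5 (toℕ u) (relax g e))) rel
          ... | no  u≢v  = subst (Relaxed j v)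
                  (sym (read-other M 5 (relax g e) (u≢v ∘ Finₚ.toℕ-injective)))
                  (relaxed-elsewhere u≢v (new v))

        skipped : Relaxed j u (M 5 (toℕ u)) → Done M
        skipped rel = let c≡ , r≡ , inp , old , _ = ready in c≡ , r≡ , inp , old , new′
          where
          new′ : ∀ v → Relaxed j v (M 5 (toℕ v))
          new′ v with u Finₚ.≟ v
          ... | yes refl = rel
          ... | no  u≢v  = relaxed-elsewhere u≢v (new v)

        difference≤B : ∀ e₁ e₂ → ∣ relax g e₁ -ℤ relax g e₂ ∣ ≤ B
        difference≤B e₁ e₂ = ℕₚ.≤-trans
          (∣i-j∣≤ (0≤relax g e₁) (0≤relax g e₂) (relax-bound g (val-bound i) e₁)
            (relax-bound g (val-bound i) e₂))
          (ℕₚ.≤-trans (ℕₚ.n≤1+n _) round≤B)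

        successor-bounded : ∀ e → ∣ relax g e +ℤ 1ℤ ∣ ≤ B
        successor-bounded e = ℕₚ.≤-trans (ℤₚ.∣i+j∣≤∣i∣+∣j∣ (relax g e) 1ℤ)
          (subst (_≤ B) (ℕₚ.+-comm 1 _) (relax≤B e))

        successor-positive : ∀ e → 0ℤ <ℤ relax g e +ℤ 1ℤ
        successor-positive e = ℤₚ.+-mono-≤-< (0≤relax g e) (+<+ (s≤s z≤n))

        improve-runs : Runs improveValue M 26 Done
        improve-runs with new u
        ... | inj₁ (z≡ , none) = _ , _ ,
                if-nonpos (add (eval-value z≡) (lit 1≤B) refl z≤n) ℤₚ.≤-refl store-exec ,
                ℕₚ.≤ᵇ⇒≤ 13 26 tt , stored (relaxed-first none)
        ... | inj₂ (b , z≡ , s , opt) = go (owner u) refl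
          where
          occupied : ∀ {p q N t} → Exec B p M N t →
            Exec B (ifPos (5 ⟨ 2 ⟨ var 8 ⟩ ⟩ ⊕ lit 1ℤ) p q) M N (7 + t)
          occupied = if-pos (add (eval-value z≡) (lit 1≤B) refl (successor-bounded b))
                            (successor-positive b)

          replace : ∀ {P} → owner u ≡ P → Better P (relax g e) (relax g b) →
                    Done (M [ 5 , toℕ u ]≔ relax g e)
          replace refl better = stored (relaxed-replace s opt better)

          keep : ∀ {P} → owner u ≡ P → Better P (relax g b) (relax g e) → Done M
          keep refl better = skipped (subst (Relaxed j u) (sym z≡) (relaxed-keep s opt better))

          alice-test : Eval B M (5 ⟨ 2 ⟨ var 8 ⟩ ⟩ ⊖ var 9) (relax g b -ℤ relax g e) 7
          alice-test = sub (eval-value z≡) (eval-var x≡) refl (difference≤B b e)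

          bob-test : Eval B M (var 9 ⊖ 5 ⟨ 2 ⟨ var 8 ⟩ ⟩) (relax g e -ℤ relax g b) 7
          bob-test = sub (eval-var x≡) (eval-value z≡) refl (difference≤B e b)

          go : ∀ P → owner u ≡ P → Runs improveValue M 26 Done
          go alice o with ℤₚ._<?_ 0ℤ (relax g b -ℤ relax g e)
          ... | yes 0<d = _ , _ ,
                  occupied (if-nonpos (eval-owner o) ℤₚ.≤-refl (if-pos alice-test 0<d store-exec)) ,
                  ℕₚ.≤-refl , replace o (ℤₚ.0≤i-j⇒j≤i (ℤₚ.<⇒≤ 0<d))
          ... | no  0≮d = _ , _ ,
                  occupied (if-nonpos (eval-owner o) ℤₚ.≤-refl
                    (if-nonpos alice-test (ℤₚ.≮⇒≥ 0≮d) skip)) ,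
                  ℕₚ.≤ᵇ⇒≤ _ 26 tt , keep o (ℤₚ.i-j≤0⇒i≤j (ℤₚ.≮⇒≥ 0≮d))
          go bob o with ℤₚ._<?_ 0ℤ (relax g e -ℤ relax g b)
          ... | yes 0<d = _ , _ ,
                  occupied (if-pos (eval-owner o) (+<+ (s≤s z≤n)) (if-pos bob-test 0<d store-exec)) ,
                  ℕₚ.≤-refl , replace o (ℤₚ.0≤i-j⇒j≤i (ℤₚ.<⇒≤ 0<d))
          ... | no  0≮d = _ , _ ,
                  occupied (if-pos (eval-owner o) (+<+ (s≤s z≤n))
                    (if-nonpos bob-test (ℤₚ.≮⇒≥ 0≮d) skip)) ,
                  ℕₚ.≤ᵇ⇒≤ _ 26 tt , keep o (ℤₚ.i-j≤0⇒i≤j (ℤₚ.≮⇒≥ 0≮d))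

      relax-runs : ∀ M → Ready M → Runs relaxEdge M 42 Done
      relax-runs M ready = seq-runs (compute-runs M ready) λ N done →
        seq-runs (clamp-runs N done) λ L (ready′ , x≡) → Improve.improve-runs L ready′ x≡

    relax-step : ∀ j M → j < m → M 8 0 ≡ + j → Scanned (suc j) M →
                 Runs relaxEdge M 42 (λ N → N 8 0 ≡ + j × Scanned j N)
    -- The loop counts in natural numbers, whereas the scan is about an edge in `Fin m`.
    relax-step j M j<m = subst
      (λ j → M 8 0 ≡ + j → Scanned (suc j) M →
             Runs relaxEdge M 42 (λ N → N 8 0 ≡ + j × Scanned j N))
      (Finₚ.toℕ-fromℕ< j<m) (λ c≡ inv → relax-runs (fromℕ< j<m) M (c≡ , inv))

    round-runs : ∀ M → M 7 0 ≡ r → HoldsInput M → (∀ v → M 5 (toℕ v) ≡ val i v) →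
      Runs (for 8 (0 ⟨ lit 0ℤ ⟩) shiftVertex ⨾ for 8 (0 ⟨ lit 1ℤ ⟩) relaxEdge) M roundCost
        (λ N → N 7 0 ≡ r × HoldsInput N × (∀ v → N 5 (toℕ v) ≡ val (suc i) v))
    round-runs M r≡ inp@(n≡ , _) vals = seq-runs
      (Countdown.for-runs 8 n n≤B shiftVertex 10 Shifted (λ _ _ _ inv → inv) shift-step
        (load (lit z≤n) (sym n≡))
        (r≡ , inp , (λ v _ → vals v) , λ v n≤v → contradiction n≤v (ℕₚ.<⇒≱ (Finₚ.toℕ<n v))))
      λ N shifted → let N , t , ex , t≤ , inv@(r≡ , inp , _) =
                          Countdown.for-runs 8 m m≤B relaxEdge 42 Scanned (λ _ _ _ inv → inv) relax-step
                            (load (lit 1≤B) (sym (proj₁ (proj₂ (proj₁ (proj₂ shifted))))))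
                            (start-scan N shifted)
                    in N , t , ex , t≤ , r≡ , inp , end-scan N inv

  After : ℕ → Memory → Set
  After k M = HoldsInput M × (∃[ i ] i + k ≡ n × (∀ v → M 5 (toℕ v) ≡ val i v))

  after-step : ∀ j M → j < n → M 7 0 ≡ + j → After (suc j) M →
    Runs (for 8 (0 ⟨ lit 0ℤ ⟩) shiftVertex ⨾ for 8 (0 ⟨ lit 1ℤ ⟩) relaxEdge) M roundCost
      (λ N → N 7 0 ≡ + j × After j N)
  after-step j M _ c≡ (inp , i , i+1+j≡n , vals)
    with N , t , ex , t≤ , c≡′ , inp′ , vals′ ← Round.round-runs (+ j) i
           (subst (i <_) i+1+j≡n (ℕₚ.m<m+n i (s≤s z≤n))) M c≡ inp vals =
    N , t , ex , t≤ , c≡′ , inp′ , suc i , trans (sym (ℕₚ.+-suc i j)) i+1+j≡n , vals′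

  iteration-runs : Runs valueIteration (input G) (4 + (n * (9 + roundCost) + 3)) (After 0)
  iteration-runs = Countdown.for-runs 7 n n≤B _ roundCost After (λ _ _ _ inv → inv) after-step
    -- Array 5 is zero in the input, so it already holds `val 0`.
    (load (lit z≤n) refl) (input-holds-input , 0 , refl , λ _ → refl)

theorem1p5 : ∃[ program ] ∃[ c ] ∃[ d ]
    ((G : GameGraph) → NoNegativeCycle G → let open GameGraph G in
    ∃[ M ] ∃[ t ]
    Exec (wordBound G d) program (input G) M t
    × t ≤ c * (m * n + 1)
    × (∀ v → ∃[ x ] IsMinSufficientEnergy G v x × M outputArray (toℕ v) ≡ encode x))
-- The time constant is that of `cost-bound`. The factor 1 in the word bound suffices, as `n`, `m`
-- and `suc (n * W)` are all at most `suc (n + m) * suc W`.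
theorem1p5 = valueIteration , 93 , 1 , run
  where
  run : (G : GameGraph) → NoNegativeCycle G → let open GameGraph G in
    ∃[ M ] ∃[ t ]
    Exec (wordBound G 1) valueIteration (input G) M t
    × t ≤ 93 * (m * n + 1)
    × (∀ v → ∃[ x ] IsMinSufficientEnergy G v x × M outputArray (toℕ v) ≡ encode x)
  run G nonneg with Correctness.iteration-runs G (wordBound G 1) n≤B m≤B values≤B
    where
    open GameGraph G
    B≡ : suc (n + m) * suc W ≡ wordBound G 1
    B≡ = sym (ℕₚ.*-identityˡ _)
    size≤B : suc (n + m) ≤ wordBound G 1
    size≤B = ℕₚ.≤-trans (ℕₚ.m≤m*n (suc (n + m)) (suc W)) (ℕₚ.≤-reflexive B≡)
    n≤B : n ≤ wordBound G 1
    n≤B = ℕₚ.≤-trans (ℕₚ.m≤n⇒m≤1+n (ℕₚ.m≤m+n n m)) size≤B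
    m≤B : m ≤ wordBound G 1
    m≤B = ℕₚ.≤-trans (ℕₚ.m≤n⇒m≤1+n (ℕₚ.m≤n+m m n)) size≤B
    values≤B : suc (n * W) ≤ wordBound G 1
    values≤B = ℕₚ.≤-trans
      (s≤s (ℕₚ.≤-trans (ℕₚ.*-mono-≤ (ℕₚ.m≤m+n n m) (ℕₚ.n≤1+n W)) (ℕₚ.m≤n+m _ W)))
      (ℕₚ.≤-reflexive B≡)
  ... | M , t , ex , t≤ , _ , i , i+0≡n , vals =
    M , t , ex , ℕₚ.≤-trans t≤ (Cost.cost-bound G) ,
    λ v → [ value v ] , value-optimal v , trans (vals v)
      (trans (cong (λ k → val k v) (trans (sym (ℕₚ.+-identityʳ i)) i+0≡n)) (sym (+value≡energy v)))
    where
    open Iteration G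
    open Optimality G nonneg
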